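{- Let $d\ge1$. (i) All unit-interval $d$-dimensional simplicial complexes are skeleton-E-chordal. (ii) All underclosed $d$-dimensional simplicial complexes are skeleton-weakly-chordal. In each dimension $d\geq 1$ both inclusions are strict: there are $d$-dimensional skeleton-E-chordal complexes that are not unit-interval, and $d$-dimensional skeleton-weakly-chordal complexes that are not underclosed.
   Context: Simplicial complexes are finite and not necessarily pure. A vertex labeling of a complex with $n$ vertices is a bijection of its vertices with $[n]=\{1,\dots,n\}$; $\min F,\max F$ denote the smallest and largest labels in $F$; the size of a face is its number of vertices. For sets $G=\{g_0<\dots<g_k\}$, $F=\{f_0<\dots<f_k\}$ of the same size, $G\le F$ componentwise means $g_i\le f_i$ for all $i$. A complex $\Delta$ with $n$ vertices is: - unit-interval, if it has a labeling such that for every facet $F$ of $\Delta$, every subset of $\{\min F,\min F+1,\dots,\max F\}$ of size $|F|$ is a face of $\Delta$; - underclosed, if it has a labeling such that for every facet $F$ of $\Delta$ and every $G\subseteq[n]$ with $|G|=|F|$, if $\min G=\min F$ and $G\le F$ componentwise, then $G\in\Delta$; - skeleton-E-chordal, if it has a labeling such that for every two faces $f\ne g$ of $\Delta$ with the same size and same maximum, every subset $h\subseteq f\cup g$ with $|h|=|f|$ is a face of $\Delta$; - skeleton-weakly-chordal, if it has a labeling such that for every two faces $f\neq g$ of $\Delta$ with the same size and same maximum, $\Delta$ contains some face $h$ with $|h|=|f|$ and $h\subseteq (f\cup g)\setminus\{\max f\}$. -}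

module Defs where

open import Data.Fin.Base using (Fin; zero; suc; _≤_)
open import Data.Fin.Permutation using (Permutation′; _⟨$⟩ʳ_)
open import Data.Fin.Subset
  using (Subset; inside; outside; _∈_; _⊆_; _∪_; _-_; ⁅_⁆; ∣_∣)
open import Data.List.Base as List using (List)
open import Data.List.Relation.Binary.Pointwise using (Pointwise)
open import Data.Nat.Base as ℕ using (ℕ)
open import Data.Product.Base using (∃-syntax; _×_)
open import Data.Vec.Base using ([]; _∷_; lookup; tabulate)
open import Level using (0ℓ)
open import Relation.Binary.PropositionalEquality using (_≡_; _≢_)
open import Relation.Unary using (Pred; Decidable)

-- A finite complex whose vertices are exactly the n elements of Fin n.
-- Decidability of being a face is part of what it means, constructively,
-- for the complex to be finite.
record SimplicialComplex (n : ℕ) : Set₁ where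
  field
    Face        : Pred (Subset n) 0ℓ
    face?       : Decidable Face
    down-closed : ∀ {F G} → G ⊆ F → Face F → Face G
    vertex      : ∀ v → Face ⁅ v ⁆

open SimplicialComplex public using (Face)

HasDimension : ∀ {n} → SimplicialComplex n → ℕ → Set
HasDimension Δ d =
  (∃[ F ] Face Δ F × ∣ F ∣ ≡ ℕ.suc d) ×
  (∀ F → Face Δ F → ∣ F ∣ ℕ.≤ ℕ.suc d)

-- A labeling sends the vertex v to the label π ⟨$⟩ʳ v.  Labels are the
-- elements of Fin n, i.e. 0,…,n-1 in place of 1,…,n.
Labeling : ℕ → Set
Labeling = Permutation′

-- The vertices whose labels lie in S.
vertices : ∀ {n} → Labeling n → Subset n → Subset n
vertices π S = tabulate λ v → lookup S (π ⟨$⟩ʳ v)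

-- The faces of Δ, written as sets of labels.
labeledFaces : ∀ {n} → SimplicialComplex n → Labeling n → Pred (Subset n) 0ℓ
labeledFaces Δ π S = Face Δ (vertices π S)

module _ {n : ℕ} where

  IsMin IsMax : Subset n → Fin n → Set
  IsMin F a = a ∈ F × (∀ x → x ∈ F → a ≤ x)
  IsMax F b = b ∈ F × (∀ x → x ∈ F → x ≤ b)

  Facet : Pred (Subset n) 0ℓ → Subset n → Set
  Facet 𝓕 F = 𝓕 F × (∀ G → 𝓕 G → F ⊆ G → G ≡ F)

-- The elements in increasing order.
elements : ∀ {n} → Subset n → List (Fin n)
elements []            = List.[]
elements (inside  ∷ F) = zero List.∷ List.map suc (elements F)
elements (outside ∷ F) = List.map suc (elements F)

_≤ᶜ_ : ∀ {n} → Subset n → Subset n → Set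
G ≤ᶜ F = Pointwise _≤_ (elements G) (elements F)

module _ {n : ℕ} (𝓕 : Pred (Subset n) 0ℓ) where

  UnitIntervalFamily : Set
  UnitIntervalFamily =
    ∀ F → Facet 𝓕 F → ∀ a b → IsMin F a → IsMax F b →
    ∀ G → (∀ x → x ∈ G → a ≤ x × x ≤ b) → ∣ G ∣ ≡ ∣ F ∣ → 𝓕 G

  UnderclosedFamily : Set
  UnderclosedFamily =
    ∀ F → Facet 𝓕 F → ∀ G → ∣ G ∣ ≡ ∣ F ∣ →
    ∀ a → IsMin F a → IsMin G a → G ≤ᶜ F → 𝓕 G

  SkeletonEChordalFamily : Set
  SkeletonEChordalFamily =
    ∀ f g → 𝓕 f → 𝓕 g → f ≢ g → ∣ f ∣ ≡ ∣ g ∣ →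
    ∀ m → IsMax f m → IsMax g m →
    ∀ h → h ⊆ f ∪ g → ∣ h ∣ ≡ ∣ f ∣ → 𝓕 h

  SkeletonWeaklyChordalFamily : Set
  SkeletonWeaklyChordalFamily =
    ∀ f g → 𝓕 f → 𝓕 g → f ≢ g → ∣ f ∣ ≡ ∣ g ∣ →
    ∀ m → IsMax f m → IsMax g m →
    ∃[ h ] 𝓕 h × ∣ h ∣ ≡ ∣ f ∣ × h ⊆ (f ∪ g) - m

module _ {n : ℕ} (Δ : SimplicialComplex n) where

  UnitInterval Underclosed SkeletonEChordal SkeletonWeaklyChordal : Set
  UnitInterval          = ∃[ π ] UnitIntervalFamily (labeledFaces Δ π)
  Underclosed           = ∃[ π ] UnderclosedFamily (labeledFaces Δ π)
  SkeletonEChordal      = ∃[ π ] SkeletonEChordalFamily (labeledFaces Δ π)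
  SkeletonWeaklyChordal = ∃[ π ] SkeletonWeaklyChordalFamily (labeledFaces Δ π)

{-# OPTIONS --safe #-}

-- Both interval conditions imply a one-step exchange property: in a facet, a
-- vertex m may be replaced by a smaller vertex above the minimum.  Given
-- distinct faces f, g of equal size with common maximum m, say min f ≤ min g, one
-- can thus trade m in f for an element of g outside f.  In a unit-interval complex
-- the interval spanned by a facet containing f contains all of f ∪ g.
--
-- A single example separates both pairs of classes: the claw with each edge
-- subdivided, next to a disjoint d-simplex.  Labeled so that every tree vertex
-- comes after its parent, it is skeleton-E-chordal, whereas no labeling of the
-- subdivided claw satisfies the exchange property.
module Submission where

open import Defs
open import Data.Nat.Base using (ℕ; _≤_)
open import Data.Product.Base using (Σ-syntax; ∃-syntax; _×_)
open import Relation.Nullary.Negation.Core using (¬_)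

open import Data.Empty using (⊥-elim) renaming (⊥ to Absurd)
open import Data.Fin.Base as Fin using (Fin; zero; suc; _↑ˡ_)
open import Data.Fin.Patterns using (0F; 1F; 2F; 3F; 4F; 5F; 6F)
open import Data.Fin.Permutation as Perm using (_⟨$⟩ʳ_; inverseʳ)
open import Data.Fin.Properties as Fin
  using (any?; <-cmp; suc-injective; ↑ˡ-injective)
open import Data.Fin.Subset
open import Data.Fin.Subset.Induction using (⊃-wellFounded)
open import Data.Fin.Subset.Properties
open import Data.List.Base as List using ([]; _∷_)
open import Data.List.Properties using (map-∘)
open import Data.List.Relation.Binary.Pointwise as Pointwise using (Pointwise; []; _∷_)
open import Data.Nat.Base as ℕ using (z≤n; s≤s)
import Data.Nat.Properties as ℕ
open import Data.Product.Base using (∃; _,_; proj₁; proj₂)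
open import Data.Sum.Base using (_⊎_; inj₁; inj₂; [_,_]′)
open import Data.Vec.Base using ([]; _∷_; here; there; lookup)
open import Data.Vec.Properties using (lookup∘tabulate; tabulate∘lookup; lookup⇒[]=; []=⇒lookup)
open import Function.Base using (_∘_; id)
open import Function.Bundles using (Injection)
open import Function.Properties.Inverse using (↔⇒↣)
open import Induction.WellFounded using (Acc; acc)
open import Relation.Binary.Definitions using (tri<; tri≈; tri>)
open import Relation.Binary.PropositionalEquality
open import Relation.Nullary.Decidable using (yes; no; decidable-stable; _×-dec_; _⊎-dec_; ¬?)
open import Relation.Unary using (Pred; Decidable)
open import Level using (0ℓ)

private
  variable
    n : ℕ

-- Finite subsets: comparison and extremal elements.

⊆-or-witness : (p q : Subset n) → p ⊆ q ⊎ (∃[ x ] x ∈ p × x ∉ q)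
⊆-or-witness p q with any? (λ x → (x ∈? p) ×-dec ¬? (x ∈? q))
... | yes w = inj₂ w
... | no ¬w = inj₁ λ {x} x∈p → decidable-stable (x ∈? q) λ x∉q → ¬w (x , x∈p , x∉q)

same-size-witness : {p q : Subset n} → p ≢ q → ∣ p ∣ ≡ ∣ q ∣ → ∃[ x ] x ∈ q × x ∉ p
same-size-witness {p = p} {q} p≢q ∣p∣≡∣q∣ with ⊆-or-witness q p | ⊆-or-witness p q
... | inj₂ w   | _        = w
... | inj₁ q⊆p | inj₁ p⊆q = ⊥-elim (p≢q (⊆-antisym p⊆q q⊆p))
... | inj₁ q⊆p | inj₂ w   = ⊥-elim (ℕ.<-irrefl (sym ∣p∣≡∣q∣) (p⊂q⇒∣p∣<∣q∣ (q⊆p , w)))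

hasMin : (F : Subset n) → Nonempty F → ∃ (IsMin F)
hasMin (inside  ∷ F) _                = zero , here , λ _ _ → z≤n
hasMin (outside ∷ F) (suc x , there x∈F) with a , a∈F , a≤ ← hasMin F (x , x∈F) =
  suc a , there a∈F , λ { (suc y) (there y∈F) → s≤s (a≤ y y∈F) }

hasMax : (F : Subset n) → Nonempty F → ∃ (IsMax F)
hasMax (s ∷ F) ne with nonempty? F
hasMax (s ∷ F) ne | yes ne′ with b , b∈F , ≤b ← hasMax F ne′ =
  suc b , there b∈F , λ { zero _ → z≤n ; (suc y) (there y∈F) → s≤s (≤b y y∈F) }
hasMax (s ∷ F) (zero , here)       | no ¬ne =
  zero , here , λ { zero _ → z≤n ; (suc y) (there y∈F) → ⊥-elim (¬ne (y , y∈F)) }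
hasMax (s ∷ F) (suc x , there x∈F) | no ¬ne = ⊥-elim (¬ne (x , x∈F))

-- Trading one element of a set for another: size, membership, componentwise order.

replace : Subset n → Fin n → Fin n → Subset n
replace p m x = (p - m) ∪ ⁅ x ⁆

∣p-x∣ : {p : Subset n} {x : Fin n} → x ∈ p → ℕ.suc ∣ p - x ∣ ≡ ∣ p ∣
∣p-x∣ {p = _       ∷ p} here        = cong (ℕ.suc ∘ ∣_∣) (p─⊥≡p p)
∣p-x∣ {p = inside  ∷ p} (there x∈p) = cong ℕ.suc (∣p-x∣ x∈p)
∣p-x∣ {p = outside ∷ p} (there x∈p) = ∣p-x∣ x∈p

∣p∪⁅x⁆∣ : {p : Subset n} {x : Fin n} → x ∉ p → ∣ p ∪ ⁅ x ⁆ ∣ ≡ ℕ.suc ∣ p ∣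
∣p∪⁅x⁆∣ {p = inside  ∷ p} {zero}  x∉p = ⊥-elim (x∉p here)
∣p∪⁅x⁆∣ {p = outside ∷ p} {zero}  x∉p = cong (ℕ.suc ∘ ∣_∣) (∪-identityʳ p)
∣p∪⁅x⁆∣ {p = inside  ∷ p} {suc x} x∉p = cong ℕ.suc (∣p∪⁅x⁆∣ (x∉p ∘ there))
∣p∪⁅x⁆∣ {p = outside ∷ p} {suc x} x∉p = ∣p∪⁅x⁆∣ (x∉p ∘ there)

∣replace∣ : {p : Subset n} {m x : Fin n} → m ∈ p → x ∉ p → ∣ replace p m x ∣ ≡ ∣ p ∣
∣replace∣ {p = p} {m} m∈p x∉p =
  trans (∣p∪⁅x⁆∣ (x∉p ∘ p─q⊆p p ⁅ m ⁆)) (∣p-x∣ m∈p)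

∈-replace⁻ : (p : Subset n) (m x : Fin n) {y : Fin n} →
             y ∈ replace p m x → (y ∈ p × y ≢ m) ⊎ y ≡ x
∈-replace⁻ p m x {y} y∈ with x∈p∪q⁻ (p - m) ⁅ x ⁆ y∈
... | inj₂ y∈⁅x⁆ = inj₂ (x∈⁅y⁆⇒x≡y x y∈⁅x⁆)
... | inj₁ y∈p-m = inj₁ (p─q⊆p p ⁅ m ⁆ y∈p-m , λ { refl → x∉p-x p y∈p-m })
  where
  x∉p-x : ∀ {n} (p : Subset n) {x : Fin n} → x ∉ p - x
  x∉p-x (_ ∷ p) {suc x} (there x∈) = x∉p-x p x∈

∈-replace⁺ : {p : Subset n} {m x y : Fin n} → y ∈ p → y ≢ m → y ∈ replace p m x
∈-replace⁺ y∈p y≢m = x∈p∪q⁺ (inj₁ (x∈p∧x≢y⇒x∈p-y y∈p y≢m))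

x∈replace : (p : Subset n) (m x : Fin n) → x ∈ replace p m x
x∈replace p m x = x∈p∪q⁺ (inj₂ (x∈⁅x⁆ x))

replace-mono : {p q : Subset n} (m x : Fin n) → p ⊆ q → replace p m x ⊆ replace q m x
replace-mono {p = p} m x p⊆q y∈ with ∈-replace⁻ p m x y∈
... | inj₁ (y∈p , y≢m) = ∈-replace⁺ (p⊆q y∈p) y≢m
... | inj₂ refl        = x∈replace _ m x

replace⊆∪- : (p q : Subset n) (m x : Fin n) → x ∈ q → x ≢ m →
             replace p m x ⊆ (p ∪ q) - m
replace⊆∪- p q m x x∈q x≢m y∈ with ∈-replace⁻ p m x y∈
... | inj₁ (y∈p , y≢m) = x∈p∧x≢y⇒x∈p-y (p⊆p∪q q y∈p) y≢m
... | inj₂ refl        = x∈p∧x≢y⇒x∈p-y (q⊆p∪q p q x∈q) x≢m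

-- g embeds the tail of a larger set, and a stands for an element inserted
-- below that tail.
remove-insert-≤ᶜ : ∀ {k n} (g : Fin k → Fin n) (a : Fin n) → (∀ i → a Fin.≤ g i) →
  (∀ {i j} → i Fin.≤ j → g i Fin.≤ g j) → {p : Subset k} {m : Fin k} → m ∈ p →
  Pointwise Fin._≤_ (a ∷ List.map g (elements (p - m))) (List.map g (elements p))
remove-insert-≤ᶜ g a a≤ mono {_ ∷ p} here = a≤ zero ∷
  subst (λ q → Pointwise Fin._≤_ (List.map g (List.map suc (elements q)))
                                 (List.map g (List.map suc (elements p))))
        (sym (p─⊥≡p p)) (Pointwise.refl Fin.≤-refl)
remove-insert-≤ᶜ g a a≤ mono {inside ∷ p} {suc m} (there m∈p) = a≤ zero ∷
  subst₂ (λ u v → Pointwise Fin._≤_ (g zero ∷ u) v)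
         (map-∘ (elements (p - m))) (map-∘ (elements p))
         (remove-insert-≤ᶜ (g ∘ suc) (g zero) (λ _ → mono z≤n) (mono ∘ s≤s) m∈p)
remove-insert-≤ᶜ g a a≤ mono {outside ∷ p} {suc m} (there m∈p) =
  subst₂ (λ u v → Pointwise Fin._≤_ (a ∷ u) v)
         (map-∘ (elements (p - m))) (map-∘ (elements p))
         (remove-insert-≤ᶜ (g ∘ suc) a (a≤ ∘ suc) (mono ∘ s≤s) m∈p)

-- Below `x` and above `m` the two increasing lists agree. In between, `x` and the elements of `p`
-- it displaces move up one position, so each stands against a larger element of `p`. The recursion
-- walks up to `x` and leaves that shift to `remove-insert-≤ᶜ`.
replace-≤ᶜ : {p : Subset n} {m x : Fin n} → m ∈ p → x ∉ p → x Fin.< m → replace p m x ≤ᶜ p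
replace-≤ᶜ {p = inside  ∷ p} {suc m} {zero}  m∈p         x∉p _ = ⊥-elim (x∉p here)
replace-≤ᶜ {p = outside ∷ p} {suc m} {zero}  (there m∈p) x∉p _ =
  subst (λ q → Pointwise Fin._≤_ (zero ∷ List.map suc (elements q)) (List.map suc (elements p)))
        (sym (∪-identityʳ (p - m)))
        (remove-insert-≤ᶜ suc zero (λ _ → z≤n) s≤s m∈p)
replace-≤ᶜ {p = inside  ∷ p} {suc m} {suc x} (there m∈p) x∉p (s≤s x<m) =
  z≤n ∷ Pointwise.map⁺ suc suc (Pointwise.map s≤s (replace-≤ᶜ m∈p (x∉p ∘ there) x<m))
replace-≤ᶜ {p = outside ∷ p} {suc m} {suc x} (there m∈p) x∉p (s≤s x<m) =
  Pointwise.map⁺ suc suc (Pointwise.map s≤s (replace-≤ᶜ m∈p (x∉p ∘ there) x<m))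

-- Used to pad a small set to the size of a facet without leaving the interval which that facet
-- spans.
grow : {p q : Subset n} {t : ℕ} → p ⊆ q → ∣ p ∣ ≤ t → t ≤ ∣ q ∣ →
       ∃[ r ] p ⊆ r × r ⊆ q × ∣ r ∣ ≡ t
grow {p = []} {[]} {ℕ.zero} p⊆q _ _ = [] , id , id , refl
grow {p = inside ∷ p} {outside ∷ q} p⊆q _ _ with () ← p⊆q here
grow {p = inside ∷ p} {inside ∷ q} {ℕ.suc t} p⊆q (s≤s p≤t) (s≤s t≤q)
  with r , p⊆r , r⊆q , ∣r∣≡t ← grow (drop-∷-⊆ p⊆q) p≤t t≤q =
  inside ∷ r , in⊆in p⊆r , in⊆in r⊆q , cong ℕ.suc ∣r∣≡t
grow {p = outside ∷ p} {outside ∷ q} p⊆q p≤t t≤q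
  with r , p⊆r , r⊆q , ∣r∣≡t ← grow (drop-∷-⊆ p⊆q) p≤t t≤q =
  outside ∷ r , out⊆ p⊆r , out⊆ r⊆q , ∣r∣≡t
grow {p = outside ∷ p} {inside ∷ q} {t} p⊆q p≤t t≤1+q with t ℕ.≤? ∣ q ∣
... | yes t≤q with r , p⊆r , r⊆q , ∣r∣≡t ← grow (drop-∷-⊆ p⊆q) p≤t t≤q =
  outside ∷ r , out⊆ p⊆r , out⊆ r⊆q , ∣r∣≡t
-- Here `t` must be one more than the size of the tail, so only the whole of `inside ∷ q` is large
-- enough.
... | no  t≰q = inside ∷ q , p⊆q , id , ℕ.≤-antisym (ℕ.≰⇒> t≰q) t≤1+q

-- The exchange property and its sources.

Exchange : Pred (Subset n) 0ℓ → Set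
Exchange {n} 𝓕 =
  ∀ F → Facet 𝓕 F → ∀ (a m x : Fin n) → IsMin F a → m ∈ F → x ∉ F →
  a Fin.< x → x Fin.< m → 𝓕 (replace F m x)

module _ {𝓕 : Pred (Subset n) 0ℓ} where

  -- The new vertex lies between the minimum and `m`, so the modified facet stays in the interval
  -- spanned by the old one.
  unitInterval⇒exchange : UnitIntervalFamily 𝓕 → Exchange 𝓕
  unitInterval⇒exchange ui F F-facet a m x a-min m∈F x∉F a<x x<m
    with b , b∈F , ≤b ← hasMax F (m , m∈F) =
    ui F F-facet a b a-min (b∈F , ≤b) (replace F m x) bounds (∣replace∣ m∈F x∉F)
    where
    bounds : ∀ y → y ∈ replace F m x → a Fin.≤ y × y Fin.≤ b
    bounds y y∈ with ∈-replace⁻ F m x y∈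
    ... | inj₁ (y∈F , _) = proj₂ a-min y y∈F , ≤b y y∈F
    ... | inj₂ refl      = ℕ.<⇒≤ a<x , ℕ.≤-trans (ℕ.<⇒≤ x<m) (≤b m m∈F)

  -- As `a` is below `x` and `x` below `m`, the minimum `a` survives the trade and remains the
  -- minimum, while the set moves down componentwise.
  underclosed⇒exchange : UnderclosedFamily 𝓕 → Exchange 𝓕
  underclosed⇒exchange uc F F-facet a m x (a∈F , a≤) m∈F x∉F a<x x<m =
    uc F F-facet (replace F m x) (∣replace∣ m∈F x∉F) a (a∈F , a≤)
      (∈-replace⁺ a∈F (Fin.<⇒≢ (ℕ.<-trans a<x x<m)) , lower) (replace-≤ᶜ m∈F x∉F x<m)
    where
    lower : ∀ y → y ∈ replace F m x → a Fin.≤ y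
    lower y y∈ with ∈-replace⁻ F m x y∈
    ... | inj₁ (y∈F , _) = a≤ y y∈F
    ... | inj₂ refl      = ℕ.<⇒≤ a<x

  -- Trading `m` in `f` for an element of `g` outside `f` gives a set of the right size inside
  -- `f ∪ g` that avoids `m`. This lets one example settle both strictness claims.
  eChordal⇒weaklyChordal : SkeletonEChordalFamily 𝓕 → SkeletonWeaklyChordalFamily 𝓕
  eChordal⇒weaklyChordal ec f g f∈ g∈ f≢g ∣f∣≡∣g∣ m f-max g-max
    with x , x∈g , x∉f ← same-size-witness f≢g ∣f∣≡∣g∣ =
    replace f m x ,
    ec f g f∈ g∈ f≢g ∣f∣≡∣g∣ m f-max g-max (replace f m x) (p─q⊆p _ ⁅ m ⁆ ∘ h⊆) ∣h∣ ,
    ∣h∣ , h⊆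
    where
    ∣h∣ = ∣replace∣ (proj₁ f-max) x∉f
    h⊆ : replace f m x ⊆ (f ∪ g) - m
    h⊆ = replace⊆∪- f g m x x∈g λ { refl → x∉f (proj₁ f-max) }

-- Facets containing a given face, and the two inclusions of classes.

module _ {𝓕 : Pred (Subset n) 0ℓ} (𝓕? : Decidable 𝓕)
         (down : ∀ {F G} → G ⊆ F → 𝓕 F → 𝓕 G) where

  -- Add vertices one at a time while the result is a face; sets cannot grow forever. When no single
  -- vertex can be added, the face is maximal, because by down-closure any larger face would contain
  -- a one-vertex extension.
  inFacet : ∀ f → 𝓕 f → ∃[ F ] Facet 𝓕 F × f ⊆ F
  inFacet f = go f (⊃-wellFounded f)
    where
    go : ∀ f → Acc _⊃_ f → 𝓕 f → ∃[ F ] Facet 𝓕 F × f ⊆ F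
    go f (acc rec) f∈ with any? (λ x → ¬? (x ∈? f) ×-dec 𝓕? (f ∪ ⁅ x ⁆))
    ... | yes (x , x∉f , f∪x∈)
      with F , F-facet , f∪x⊆F ← go (f ∪ ⁅ x ⁆)
             (rec (p⊆p∪q ⁅ x ⁆ , x , q⊆p∪q f ⁅ x ⁆ (x∈⁅x⁆ x) , x∉f)) f∪x∈ =
      F , F-facet , f∪x⊆F ∘ p⊆p∪q ⁅ x ⁆
    ... | no ¬extendable = f , (f∈ , maximal) , id
      where
      maximal : ∀ G → 𝓕 G → f ⊆ G → G ≡ f
      maximal G G∈ f⊆G with ⊆-or-witness G f
      ... | inj₁ G⊆f = ⊆-antisym G⊆f f⊆G
      ... | inj₂ (x , x∈G , x∉f) = ⊥-elim (¬extendable (x , x∉f , down f∪x⊆G G∈))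
        where
        f∪x⊆G : f ∪ ⁅ x ⁆ ⊆ G
        f∪x⊆G y∈ with x∈p∪q⁻ f ⁅ x ⁆ y∈
        ... | inj₁ y∈f = f⊆G y∈f
        ... | inj₂ y∈x with refl ← x∈⁅y⁆⇒x≡y x y∈x = x∈G

  private
    -- A facet `F` containing `f` starts at or below `a` and ends at or above `m`, so its interval
    -- contains `f ∪ g` and hence `h`. Since `F` may be larger than `h`, elements of `F` are added
    -- to `h` until the sizes match; the result is a face, and so is its subset `h`.
    eChordal-lowerMin : UnitIntervalFamily 𝓕 → ∀ f g → 𝓕 f → ∀ {a b m} →
      IsMin f a → IsMin g b → a Fin.≤ b → IsMax f m → IsMax g m →
      ∀ h → h ⊆ f ∪ g → ∣ h ∣ ≡ ∣ f ∣ → 𝓕 h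
    eChordal-lowerMin ui f g f∈ {a} {b} {m} (a∈f , a≤) (_ , b≤) a≤b (m∈f , ≤m) (_ , ≤m′) h h⊆ ∣h∣≡∣f∣
      with F , F-facet , f⊆F ← inFacet f f∈
      with u , u-min ← hasMin F (m , f⊆F m∈f)
         | v , v-max ← hasMax F (m , f⊆F m∈f)
      with G , h⊆G , G⊆h∪F , ∣G∣≡∣F∣ ← grow {p = h} {q = h ∪ F} (p⊆p∪q F)
             (subst (_≤ ∣ F ∣) (sym ∣h∣≡∣f∣) (p⊆q⇒∣p∣≤∣q∣ f⊆F)) (∣q∣≤∣p∪q∣ h F) =
      down h⊆G (ui F F-facet u v u-min v-max G bounds ∣G∣≡∣F∣)
      where
      above : ∀ {y} → a Fin.≤ y → u Fin.≤ y
      above = ℕ.≤-trans (proj₂ u-min a (f⊆F a∈f))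

      below : ∀ {y} → y Fin.≤ m → y Fin.≤ v
      below y≤m = ℕ.≤-trans y≤m (proj₂ v-max m (f⊆F m∈f))

      bounds : ∀ y → y ∈ G → u Fin.≤ y × y Fin.≤ v
      bounds y y∈G with x∈p∪q⁻ h F (G⊆h∪F y∈G)
      ... | inj₂ y∈F = proj₂ u-min y y∈F , proj₂ v-max y y∈F
      ... | inj₁ y∈h with x∈p∪q⁻ f g (h⊆ y∈h)
      ...   | inj₁ y∈f = above (a≤ y y∈f) , below (≤m y y∈f)
      ...   | inj₂ y∈g = above (ℕ.≤-trans a≤b (b≤ y y∈g)) , below (≤m′ y y∈g)

    -- An element `x` of `g` outside `f` satisfies `a < x < m`. In a facet `F` containing `f`,
    -- either `x` is already present and the traded set lies in `F`, or `m` is exchanged for `x` in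
    -- `F` and the result restricted. The maximum `m` of `f` may be an interior element of `F`,
    -- which is why `Exchange` allows any `m` above `x`.
    weaklyChordal-lowerMin : Exchange 𝓕 → ∀ f g → 𝓕 f → f ≢ g → ∣ f ∣ ≡ ∣ g ∣ → ∀ {a b m} →
      IsMin f a → IsMin g b → a Fin.≤ b → IsMax f m → IsMax g m →
      ∃[ h ] 𝓕 h × ∣ h ∣ ≡ ∣ f ∣ × h ⊆ (f ∪ g) - m
    weaklyChordal-lowerMin ex f g f∈ f≢g ∣f∣≡∣g∣ {a} {b} {m} (a∈f , _) (_ , b≤) a≤b (m∈f , _) (_ , ≤m)
      with x , x∈g , x∉f ← same-size-witness f≢g ∣f∣≡∣g∣ =
      replace f m x , face , ∣replace∣ m∈f x∉f , replace⊆∪- f g m x x∈g x≢m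
      where
      x≢m : x ≢ m
      x≢m refl = x∉f m∈f

      a<x : a Fin.< x
      a<x = Fin.≤∧≢⇒< (ℕ.≤-trans a≤b (b≤ x x∈g)) λ { refl → x∉f a∈f }

      face : 𝓕 (replace f m x)
      face with F , F-facet , f⊆F ← inFacet f f∈ with x ∈? F
      ... | no x∉F with u , u-min ← hasMin F (m , f⊆F m∈f) =
        down (replace-mono m x f⊆F)
          (ex F F-facet u m x u-min (f⊆F m∈f) x∉F
            (ℕ.≤-<-trans (proj₂ u-min a (f⊆F a∈f)) a<x) (Fin.≤∧≢⇒< (≤m x x∈g) x≢m))
      ... | yes x∈F = down replace⊆F (proj₁ F-facet)
        where
        replace⊆F : replace f m x ⊆ F
        replace⊆F y∈ with ∈-replace⁻ f m x y∈
        ... | inj₁ (y∈f , _) = f⊆F y∈f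
        ... | inj₂ refl      = x∈F

  unitInterval⇒eChordal : UnitIntervalFamily 𝓕 → SkeletonEChordalFamily 𝓕
  unitInterval⇒eChordal ui f g f∈ g∈ _ ∣f∣≡∣g∣ m f-max g-max h h⊆ ∣h∣≡∣f∣
    with a , a-min ← hasMin f (m , proj₁ f-max)
       | b , b-min ← hasMin g (m , proj₁ g-max)
    with Fin.≤-total a b
  ... | inj₁ a≤b = eChordal-lowerMin ui f g f∈ a-min b-min a≤b f-max g-max h h⊆ ∣h∣≡∣f∣
  ... | inj₂ b≤a = eChordal-lowerMin ui g f g∈ b-min a-min b≤a g-max f-max h
                     (subst (h ⊆_) (∪-comm f g) h⊆) (trans ∣h∣≡∣f∣ ∣f∣≡∣g∣)

  exchange⇒weaklyChordal : Exchange 𝓕 → SkeletonWeaklyChordalFamily 𝓕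
  exchange⇒weaklyChordal ex f g f∈ g∈ f≢g ∣f∣≡∣g∣ m f-max g-max
    with a , a-min ← hasMin f (m , proj₁ f-max)
       | b , b-min ← hasMin g (m , proj₁ g-max)
    with Fin.≤-total a b
  ... | inj₁ a≤b =
    weaklyChordal-lowerMin ex f g f∈ f≢g ∣f∣≡∣g∣ a-min b-min a≤b f-max g-max
  ... | inj₂ b≤a
    with h , h∈ , ∣h∣≡∣g∣ , h⊆ ← weaklyChordal-lowerMin ex g f g∈ (f≢g ∘ sym) (sym ∣f∣≡∣g∣)
           b-min a-min b≤a g-max f-max =
    h , h∈ , trans ∣h∣≡∣g∣ (sym ∣f∣≡∣g∣) , subst (λ p → h ⊆ p - m) (∪-comm g f) h⊆

-- Labels versus vertices, and exchange along an edge.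

module _ (π : Labeling n) where

  label-injective : ∀ {u v} → π ⟨$⟩ʳ u ≡ π ⟨$⟩ʳ v → u ≡ v
  label-injective = Injection.injective (↔⇒↣ π)

  ∈-vertices⁺ : ∀ {S v} → π ⟨$⟩ʳ v ∈ S → v ∈ vertices π S
  ∈-vertices⁺ {S} {v} πv∈S = lookup⇒[]= v (vertices π S)
    (trans (lookup∘tabulate (λ v → lookup S (π ⟨$⟩ʳ v)) v) ([]=⇒lookup πv∈S))

  ∈-vertices⁻ : ∀ {S v} → v ∈ vertices π S → π ⟨$⟩ʳ v ∈ S
  ∈-vertices⁻ {S} {v} v∈ = lookup⇒[]= (π ⟨$⟩ʳ v) S
    (trans (sym (lookup∘tabulate (λ v → lookup S (π ⟨$⟩ʳ v)) v)) ([]=⇒lookup v∈))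

  vertices-mono : ∀ {F G} → G ⊆ F → vertices π G ⊆ vertices π F
  vertices-mono G⊆F v∈ = ∈-vertices⁺ (G⊆F (∈-vertices⁻ v∈))

pair : Fin n → Fin n → Subset n
pair a b = ⁅ a ⁆ ∪ ⁅ b ⁆

∈-pair⁻ : {a b x : Fin n} → x ∈ pair a b → x ≡ a ⊎ x ≡ b
∈-pair⁻ {a = a} {b} x∈ with x∈p∪q⁻ ⁅ a ⁆ ⁅ b ⁆ x∈
... | inj₁ x∈a = inj₁ (x∈⁅y⁆⇒x≡y a x∈a)
... | inj₂ x∈b = inj₂ (x∈⁅y⁆⇒x≡y b x∈b)

∈-pairˡ : (a b : Fin n) → a ∈ pair a b
∈-pairˡ a b = p⊆p∪q ⁅ b ⁆ (x∈⁅x⁆ a)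

∈-pairʳ : (a b : Fin n) → b ∈ pair a b
∈-pairʳ a b = q⊆p∪q ⁅ a ⁆ ⁅ b ⁆ (x∈⁅x⁆ b)

module _ (Δ : SimplicialComplex n) where

  Linked : Fin n → Fin n → Set
  Linked u v = ∃[ F ] Face Δ F × u ∈ F × v ∈ F

  -- For distinct `u` and `v`: the edge on them is a facet. Maximality is phrased on vertices, so
  -- that it can be checked once for all labelings.
  FacetEdge : Fin n → Fin n → Set
  FacetEdge u v = Linked u v × (∀ F → Face Δ F → u ∈ F → v ∈ F → F ⊆ pair u v)

  FacetEdge-sym : ∀ {u v} → FacetEdge u v → FacetEdge v u
  FacetEdge-sym {u} {v} ((F , F∈ , u∈ , v∈) , max) =
    (F , F∈ , v∈ , u∈) , λ G G∈ v∈ u∈ → subst (G ⊆_) (∪-comm ⁅ u ⁆ ⁅ v ⁆) (max G G∈ u∈ v∈)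

  module _ (π : Labeling n) (ex : Exchange (labeledFaces Δ π)) where

    -- The labels of `u` and `v` form a facet with minimum `ℓu`; exchanging `ℓv` for `ℓw` leaves a
    -- face that contains both `u` and `w`.
    exchange-edge : ∀ {u v w} → FacetEdge u v →
                    (π ⟨$⟩ʳ u) Fin.< (π ⟨$⟩ʳ w) → (π ⟨$⟩ʳ w) Fin.< (π ⟨$⟩ʳ v) → Linked u w
    exchange-edge {u} {v} {w} ((H , H∈ , u∈H , v∈H) , max) u<w w<v =
      vertices π G , ex F F-facet ℓu ℓv ℓw u-min (∈-pairʳ ℓu ℓv) w∉F u<w w<v ,
      ∈-vertices⁺ π (∈-replace⁺ (∈-pairˡ ℓu ℓv) (Fin.<⇒≢ u<v)) ,
      ∈-vertices⁺ π (x∈replace F ℓv ℓw)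
      where
      ℓu = π ⟨$⟩ʳ u
      ℓv = π ⟨$⟩ʳ v
      ℓw = π ⟨$⟩ʳ w
      F  = pair ℓu ℓv
      G  = replace F ℓv ℓw

      u<v : ℓu Fin.< ℓv
      u<v = ℕ.<-trans u<w w<v

      u-min : IsMin F ℓu
      u-min = ∈-pairˡ ℓu ℓv , λ x x∈F →
        [ (λ { refl → ℕ.≤-refl }) , (λ { refl → ℕ.<⇒≤ u<v }) ]′ (∈-pair⁻ x∈F)

      w∉F : ℓw ∉ F
      w∉F w∈F = [ Fin.<⇒≢ u<w ∘ sym , Fin.<⇒≢ w<v ]′ (∈-pair⁻ w∈F)

      verticesF⊆H : vertices π F ⊆ H
      verticesF⊆H x∈ with ∈-pair⁻ (∈-vertices⁻ π x∈)
      ... | inj₁ eq with refl ← label-injective π eq = u∈H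
      ... | inj₂ eq with refl ← label-injective π eq = v∈H

      F-facet : Facet (labeledFaces Δ π) F
      F-facet = SimplicialComplex.down-closed Δ verticesF⊆H H∈ , λ K K∈ F⊆K →
        ⊆-antisym (λ {x} x∈K → K⊆F K K∈ F⊆K x∈K) F⊆K
        where
        K⊆F : ∀ K → labeledFaces Δ π K → F ⊆ K → K ⊆ F
        -- `K` consists of labels while `max` concerns vertices, so the label `x` is pulled back
        -- along `π`, compared there, and pushed forward again.
        K⊆F K K∈ F⊆K {x} x∈K
          with ∈-pair⁻ (max (vertices π K) K∈
                 (∈-vertices⁺ π (F⊆K (∈-pairˡ ℓu ℓv))) (∈-vertices⁺ π (F⊆K (∈-pairʳ ℓu ℓv)))
                 (∈-vertices⁺ π (subst (_∈ K) (sym (inverseʳ π)) x∈K)))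
        ... | inj₁ eq = subst (_∈ F) (trans (cong (π ⟨$⟩ʳ_) (sym eq)) (inverseʳ π)) (∈-pairˡ ℓu ℓv)
        ... | inj₂ eq = subst (_∈ F) (trans (cong (π ⟨$⟩ʳ_) (sym eq)) (inverseʳ π)) (∈-pairʳ ℓu ℓv)

-- Forests with a simplex on isolated roots.

-- The roots are the fixed points of parent; the simplex sits on isolated roots.
module Forest (parent : Fin n → Fin n) (parent≤ : ∀ k → parent k Fin.≤ k)
              (simplex : Subset n) (fixed : ∀ {k} → k ∈ simplex → parent k ≡ k) where

  forest : SimplicialComplex n
  forest = record
    { Face        = λ F → (∃[ k ] F ⊆ pair (parent k) k) ⊎ F ⊆ simplex
    ; face?       = λ F → any? (λ k → F ⊆? pair (parent k) k) ⊎-dec (F ⊆? simplex)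
    ; down-closed = λ { G⊆F (inj₁ (k , F⊆)) → inj₁ (k , F⊆ ∘ G⊆F)
                      ; G⊆F (inj₂ F⊆)       → inj₂ (F⊆ ∘ G⊆F) }
    ; vertex      = λ v → inj₁ (v , q⊆p∪q ⁅ parent v ⁆ ⁅ v ⁆)
    }

  forest-dimension : ∀ {d} → 1 ≤ d → ∣ simplex ∣ ≡ ℕ.suc d → HasDimension forest d
  forest-dimension 1≤d ∣simplex∣ = (simplex , inj₂ id , ∣simplex∣) , λ
    -- Faces of the forest have at most two vertices, which fits because `d` is at least 1.
    { F (inj₁ (k , F⊆)) → ℕ.≤-trans (p⊆q⇒∣p∣≤∣q∣ F⊆) (ℕ.≤-trans (∣pair∣≤2 (parent k) k) (s≤s 1≤d))
    ; F (inj₂ F⊆)       → subst (∣ F ∣ ≤_) ∣simplex∣ (p⊆q⇒∣p∣≤∣q∣ F⊆) }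
    where
    ∣pair∣≤2 : (a b : Fin n) → ∣ pair a b ∣ ≤ 2
    ∣pair∣≤2 a b with b ∈? ⁅ a ⁆
    ... | no b∉a = ℕ.≤-reflexive (trans (∣p∪⁅x⁆∣ b∉a) (cong ℕ.suc (∣⁅x⁆∣≡1 a)))
    ... | yes b∈a with refl ← x∈⁅y⁆⇒x≡y a b∈a =
      subst (_≤ 2) (sym (trans (cong ∣_∣ (∪-idem ⁅ a ⁆)) (∣⁅x⁆∣≡1 a))) (s≤s z≤n)

  -- Parents come no later than their children, so the maximum of a face inside `pair (parent k) k`
  -- is normally `k`. If it is `parent k`, then `k` can lie in `F` only by coinciding with it, and
  -- `F` contains nothing but `m`.
  face-with-max : ∀ {F m} → Face forest F → IsMax F m → F ⊆ pair (parent m) m ⊎ F ⊆ simplex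
  face-with-max (inj₂ F⊆) _ = inj₂ F⊆
  face-with-max {F} {m} (inj₁ (k , F⊆)) (m∈F , ≤m) with ∈-pair⁻ (F⊆ m∈F)
  ... | inj₂ refl = inj₁ F⊆
  ... | inj₁ refl = inj₁ λ {x} x∈F → subst (_∈ pair (parent m) m)
    (sym ([ id , (λ { refl → Fin.≤-antisym (≤m x x∈F) (parent≤ x) }) ]′ (∈-pair⁻ (F⊆ x∈F))))
    (∈-pairʳ (parent m) m)

  -- Under the identity labeling the maximum `m` confines a face to one edge or to the simplex. Two
  -- faces with the same maximum therefore lie in a common face: in the mixed case `m` is an
  -- isolated root, and its pair collapses to a point of the simplex. Every subset of their union is
  -- then a face.
  forest-eChordal : SkeletonEChordal forest
  forest-eChordal = Perm.id , λ f g f∈ g∈ _ _ m f-max g-max h h⊆ _ →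
    -- For the identity labeling `vertices` rebuilds a set from its own lookups, which equals the
    -- set only propositionally.
    subst (Face forest) (sym (tabulate∘lookup h))
      (union f g (subst (Face forest) (tabulate∘lookup f) f∈)
                 (subst (Face forest) (tabulate∘lookup g) g∈) f-max g-max h⊆)
    where
    ∪-least : ∀ {p q r : Subset n} → p ⊆ r → q ⊆ r → p ∪ q ⊆ r
    ∪-least {p} {q} p⊆r q⊆r x∈ = [ p⊆r , q⊆r ]′ (x∈p∪q⁻ p q x∈)

    isolated : ∀ {p m} → m ∈ simplex → p ⊆ pair (parent m) m → p ⊆ simplex
    isolated m∈ p⊆ x∈ with ∈-pair⁻ (p⊆ x∈)
    ... | inj₁ refl = subst (_∈ simplex) (sym (fixed m∈)) m∈
    ... | inj₂ refl = m∈

    union : ∀ f g → Face forest f → Face forest g → ∀ {m} → IsMax f m → IsMax g m →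
            ∀ {h} → h ⊆ f ∪ g → Face forest h
    union f g f∈ g∈ {m} f-max g-max h⊆ with face-with-max f∈ f-max | face-with-max g∈ g-max
    ... | inj₁ f⊆ | inj₁ g⊆ = inj₁ (m , ∪-least f⊆ g⊆ ∘ h⊆)
    ... | inj₂ f⊆ | inj₂ g⊆ = inj₂ (∪-least f⊆ g⊆ ∘ h⊆)
    ... | inj₁ f⊆ | inj₂ g⊆ = inj₂ (∪-least (isolated (g⊆ (proj₁ g-max)) f⊆) g⊆ ∘ h⊆)
    ... | inj₂ f⊆ | inj₁ g⊆ = inj₂ (∪-least f⊆ (isolated (f⊆ (proj₁ f-max)) g⊆) ∘ h⊆)

  linked⇒adjacent : ∀ {u v} → u ∉ simplex → Linked forest u v → u ≡ v ⊎ u ≡ parent v ⊎ v ≡ parent u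
  linked⇒adjacent u∉ (F , inj₂ F⊆ , u∈ , v∈) = ⊥-elim (u∉ (F⊆ u∈))
  linked⇒adjacent u∉ (F , inj₁ (k , F⊆) , u∈ , v∈) with ∈-pair⁻ (F⊆ u∈) | ∈-pair⁻ (F⊆ v∈)
  ... | inj₁ refl | inj₁ refl = inj₁ refl
  ... | inj₂ refl | inj₂ refl = inj₁ refl
  ... | inj₁ refl | inj₂ refl = inj₂ (inj₁ refl)
  ... | inj₂ refl | inj₁ refl = inj₂ (inj₂ refl)

  -- A vertex of the simplex is its own parent, so `v` is not in it. Another pair could contain both
  -- ends only if each were the parent of the other, and `parent≤` would then make them equal.
  tree-edge : ∀ {u v} → parent v ≡ u → u ≢ v → FacetEdge forest u v
  tree-edge {v = v} refl u≢v =
    (pair (parent v) v , inj₁ (v , id) , ∈-pairˡ (parent v) v , ∈-pairʳ (parent v) v) , maximal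
    where
    maximal : ∀ F → Face forest F → parent v ∈ F → v ∈ F → F ⊆ pair (parent v) v
    maximal F (inj₂ F⊆) _ v∈F = ⊥-elim (u≢v (fixed (F⊆ v∈F)))
    maximal F (inj₁ (k , F⊆)) u∈F v∈F with ∈-pair⁻ (F⊆ v∈F) | ∈-pair⁻ (F⊆ u∈F)
    ... | inj₂ refl | _         = F⊆
    ... | inj₁ v≡pk | inj₁ u≡pk = ⊥-elim (u≢v (trans u≡pk (sym v≡pk)))
    ... | inj₁ refl | inj₂ u≡k  =
      ⊥-elim (u≢v (Fin.≤-antisym (parent≤ v) (subst (v Fin.≤_) (sym u≡k) (parent≤ k))))

-- The subdivided claw beside a disjoint simplex.

module Spider (m : ℕ) where

  center : Fin (7 ℕ.+ m)
  center = zero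

  -- Leg `i` consists of vertices `1 + i` and `4 + i`; the last `m` vertices are the isolated roots
  -- that carry the simplex.
  middle tip : Fin 3 → Fin (7 ℕ.+ m)
  middle i = suc (i ↑ˡ (3 ℕ.+ m))
  tip    i = suc (suc (suc (suc (i ↑ˡ m))))

  parent : Fin (7 ℕ.+ m) → Fin (7 ℕ.+ m)
  parent 0F = center
  parent 1F = center
  parent 2F = center
  parent 3F = center
  parent 4F = middle 0F
  parent 5F = middle 1F
  parent 6F = middle 2F
  parent (suc (suc (suc (suc (suc (suc (suc k))))))) = suc (suc (suc (suc (suc (suc (suc k))))))

  parent≤ : ∀ k → parent k Fin.≤ k
  parent≤ 0F = z≤n
  parent≤ 1F = z≤n
  parent≤ 2F = z≤n
  parent≤ 3F = z≤n
  parent≤ 4F = s≤s z≤n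
  parent≤ 5F = s≤s (s≤s z≤n)
  parent≤ 6F = s≤s (s≤s (s≤s z≤n))
  parent≤ (suc (suc (suc (suc (suc (suc (suc k))))))) = ℕ.≤-refl

  simplex : Subset (7 ℕ.+ m)
  simplex = outside ∷ outside ∷ outside ∷ outside ∷ outside ∷ outside ∷ outside ∷ ⊤

  fixed : ∀ {k} → k ∈ simplex → parent k ≡ k
  fixed (there (there (there (there (there (there (there _))))))) = refl

  open Forest parent parent≤ simplex fixed

  parent-middle : ∀ i → parent (middle i) ≡ center
  parent-middle 0F = refl
  parent-middle 1F = refl
  parent-middle 2F = refl

  parent-tip : ∀ i → parent (tip i) ≡ middle i
  parent-tip 0F = refl
  parent-tip 1F = refl
  parent-tip 2F = refl

  center∉simplex : center ∉ simplex
  center∉simplex ()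

  middle∉simplex : ∀ i → middle i ∉ simplex
  middle∉simplex 0F (there ())
  middle∉simplex 1F (there (there ()))
  middle∉simplex 2F (there (there (there ())))

  middle-injective : ∀ {i j} → middle i ≡ middle j → i ≡ j
  middle-injective eq = ↑ˡ-injective (3 ℕ.+ m) _ _ (suc-injective eq)

  tip≢middle : ∀ {i j} → tip i ≢ middle j
  tip≢middle {i} {j} eq
    with () ← trans (sym (parent-tip i)) (trans (cong parent eq) (parent-middle j))

  middles-unlinked : ∀ {i j} → i ≢ j → ¬ Linked forest (middle i) (middle j)
  middles-unlinked {i} {j} i≢j link with linked⇒adjacent (middle∉simplex i) link
  ... | inj₁ eq = i≢j (middle-injective eq)
  ... | inj₂ (inj₁ eq) with () ← trans eq (parent-middle j)
  ... | inj₂ (inj₂ eq) with () ← trans eq (parent-middle i)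

  center-tip-unlinked : ∀ {i} → ¬ Linked forest center (tip i)
  center-tip-unlinked {i} link with linked⇒adjacent center∉simplex link
  ... | inj₂ (inj₁ eq) with () ← trans eq (parent-tip i)

  center-middle : ∀ i → FacetEdge forest center (middle i)
  center-middle i = tree-edge (parent-middle i) (λ ())

  middle-tip : ∀ i → FacetEdge forest (middle i) (tip i)
  middle-tip i = tree-edge (parent-tip i) (tip≢middle ∘ sym)

  Linked-sym : ∀ {u v} → Linked forest u v → Linked forest v u
  Linked-sym (F , F∈ , u∈ , v∈) = F , F∈ , v∈ , u∈

  module _ (π : Labeling (7 ℕ.+ m)) (ex : Exchange (labeledFaces forest π)) where

    private
      ℓ : Fin (7 ℕ.+ m) → Fin (7 ℕ.+ m)
      ℓ v = π ⟨$⟩ʳ v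

      exchange : ∀ {u v w} → FacetEdge forest u v → ℓ u Fin.< ℓ w → ℓ w Fin.< ℓ v → Linked forest u w
      exchange = exchange-edge forest π ex

      compare : ∀ {u v} → u ≢ v → ℓ u Fin.< ℓ v ⊎ ℓ v Fin.< ℓ u
      compare {u} {v} u≢v with <-cmp (ℓ u) (ℓ v)
      ... | tri< u<v _ _ = inj₁ u<v
      ... | tri≈ _ eq _  = ⊥-elim (u≢v (label-injective π eq))
      ... | tri> _ _ v<u = inj₂ v<u

    -- On the edge from the lower middle vertex to the center, the center can be exchanged for the
    -- other middle vertex, which would link two different legs.
    ¬two-below : ∀ {i j} → i ≢ j → ℓ (middle i) Fin.< ℓ center → ℓ (middle j) Fin.< ℓ center → Absurd
    ¬two-below {i} {j} i≢j i<c j<c with compare (i≢j ∘ middle-injective)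
    ... | inj₁ i<j = middles-unlinked i≢j (exchange (FacetEdge-sym forest (center-middle i)) i<j j<c)
    ... | inj₂ j<i = middles-unlinked (i≢j ∘ sym) (exchange (FacetEdge-sym forest (center-middle j)) j<i i<c)

    -- Wherever the tip of the lower leg is placed, an exchange joins two
    -- vertices that are not adjacent.
    ¬two-above-ordered : ∀ {i j} → i ≢ j → ℓ center Fin.< ℓ (middle i) →
                         ℓ (middle i) Fin.< ℓ (middle j) → Absurd
    ¬two-above-ordered {i} {j} i≢j c<i i<j with compare {center} {tip i} (λ ())
    ... | inj₂ t<c = center-tip-unlinked {i}
      (Linked-sym (exchange (FacetEdge-sym forest (middle-tip i)) t<c c<i))
    ... | inj₁ c<t with compare {tip i} {middle j} tip≢middle
    ...   | inj₁ t<j = center-tip-unlinked {i} (exchange (center-middle j) c<t t<j)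
    ...   | inj₂ j<t = middles-unlinked i≢j (exchange (middle-tip i) i<j j<t)

    ¬two-above : ∀ {i j} → i ≢ j → ℓ center Fin.< ℓ (middle i) → ℓ center Fin.< ℓ (middle j) → Absurd
    ¬two-above i≢j c<i c<j with compare (i≢j ∘ middle-injective)
    ... | inj₁ i<j = ¬two-above-ordered i≢j c<i i<j
    ... | inj₂ j<i = ¬two-above-ordered (i≢j ∘ sym) c<j j<i

    -- By pigeonhole, two of the three middle vertices lie on the same side of the center.
    ¬exchange : Absurd
    ¬exchange with compare {middle 0F} {center} (λ ())
                 | compare {middle 1F} {center} (λ ())
                 | compare {middle 2F} {center} (λ ())
    ... | inj₁ p | inj₁ q | _      = ¬two-below {0F} {1F} (λ ()) p q
    ... | inj₂ p | inj₂ q | _      = ¬two-above {0F} {1F} (λ ()) p q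
    ... | inj₁ p | inj₂ q | inj₁ r = ¬two-below {0F} {2F} (λ ()) p r
    ... | inj₁ p | inj₂ q | inj₂ r = ¬two-above {1F} {2F} (λ ()) q r
    ... | inj₂ p | inj₁ q | inj₁ r = ¬two-below {1F} {2F} (λ ()) q r
    ... | inj₂ p | inj₁ q | inj₂ r = ¬two-above {0F} {2F} (λ ()) p r

theorem40 : ∀ (d : ℕ) → 1 ≤ d →
    (∀ {n} (Δ : SimplicialComplex n) → HasDimension Δ d → UnitInterval Δ → SkeletonEChordal Δ) ×
    (∀ {n} (Δ : SimplicialComplex n) → HasDimension Δ d → Underclosed Δ → SkeletonWeaklyChordal Δ) ×
    (∃[ n ] Σ[ Δ ∈ SimplicialComplex n ] HasDimension Δ d × SkeletonEChordal Δ × ¬ UnitInterval Δ) ×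
    (∃[ n ] Σ[ Δ ∈ SimplicialComplex n ] HasDimension Δ d × SkeletonWeaklyChordal Δ × ¬ Underclosed Δ)
theorem40 d 1≤d =
  (λ Δ _ (π , ui) → π , unitInterval⇒eChordal (labeled? Δ π) (labeled-down Δ π) ui) ,
  (λ Δ _ (π , uc) → π , exchange⇒weaklyChordal (labeled? Δ π) (labeled-down Δ π)
                          (underclosed⇒exchange uc)) ,
  (_ , spider , dimension , eChordal , λ (π , ui) → ¬exchange π (unitInterval⇒exchange ui)) ,
  (_ , spider , dimension , (proj₁ eChordal , eChordal⇒weaklyChordal (proj₂ eChordal)) ,
    λ (π , uc) → ¬exchange π (underclosed⇒exchange uc))
  where
  -- A simplex of dimension `d` has `d + 1` vertices.
  open Spider (ℕ.suc d)
  open Forest parent parent≤ simplex fixed renaming (forest to spider; forest-eChordal to eChordal)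

  dimension : HasDimension spider d
  dimension = forest-dimension 1≤d (∣⊤∣≡n (ℕ.suc d))

  labeled? : ∀ {n} (Δ : SimplicialComplex n) π → Decidable (labeledFaces Δ π)
  labeled? Δ π S = SimplicialComplex.face? Δ (vertices π S)

  labeled-down : ∀ {n} (Δ : SimplicialComplex n) π {F G} → G ⊆ F →
                 labeledFaces Δ π F → labeledFaces Δ π G
  labeled-down Δ π G⊆F = SimplicialComplex.down-closed Δ (vertices-mono π G⊆F)
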